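{- Let $n\ge2$ with $n\equiv 1\pmod 4$. Then the number of equiparity Latin squares in the ensemble of any $\mathrm{OA}(n+1,n)$ is at least $(n+1)(n-1)(n-3)/24$.
   Context: An orthogonal array $\mathrm{OA}(k,n)$ on an alphabet $\Lambda$ with $|\Lambda|=n$ is an $n^2\times k$ matrix $A=(a_{r\ell})$ with entries in $\Lambda$ such that in every pair of distinct columns each ordered pair in $\Lambda^2$ occurs in exactly one row. The ensemble of $A$ is the family of Latin squares indexed by the $\binom{k}{3}$ choices of columns $i<j<\ell$ of $A$ (Latin squares are counted once for each choice of three columns): the Latin square for $i<j<\ell$ has rows and columns indexed by $\Lambda$, and for each row $r$ of $A$ its entry in row $a_{ri}$, column $a_{rj}$ is $a_{r\ell}$. For a Latin square $L=(l_{xy})$ with rows, columns and symbols indexed by $\Lambda$, the row-parity $\pi_r\in\mathbb{Z}_2$ is the sum of the parities ($0$ even, $1$ odd) of the $n$ permutations $y\mapsto l_{xy}$ ($x\in\Lambda$ fixed); the column-parity $\pi_c$ is the sum of the parities of the $n$ permutations $x\mapsto l_{xy}$ ($y$ fixed); the symbol-parity $\pi_s$ is the sum of the parities of the $n$ permutations mapping $x\mapsto y$ whenever $l_{xy}=s$ ($s$ fixed). $L$ is equiparity if $\pi_r=\pi_c=\pi_s$. -}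

module Defs where

open import Level using (Level)
open import Data.Bool.Base using (if_then_else_)
open import Data.Fin.Base using (Fin; _<_)
open import Data.Fin.Permutation using (Permutation′; _⟨$⟩ʳ_; _∘ₚ_)
open import Data.Fin.Properties using (_<?_; <⇒≢; <-trans)
open import Data.List.Base
  using (List; allFin; cartesianProduct; filter; length; mapMaybe)
open import Data.Maybe.Base as Maybe using (Maybe)
open import Data.Nat.Base using (ℕ; _^_; parity)
import Data.Nat.Properties as ℕ
open import Data.Parity.Base using (Parity)
import Data.Parity.Properties as ℙ
open import Data.Product using (∃!; _×_; _,_; proj₁; proj₂)
open import Function.Base using (_∘_)
open import Function.Bundles using (_↔_; Inverse; mk⤖)
open import Function.Construct.Composition using (_↔-∘_)
open import Function.Construct.Symmetry using (↔-sym)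
open import Function.Definitions using (Bijective; Injective; Surjective)
open import Function.Properties.Bijection using (⤖⇒↔)
open import Relation.Binary.PropositionalEquality.Core
  using (_≡_; _≢_; refl; sym; trans; cong; subst)
open import Relation.Nullary.Decidable.Core
  using (Dec; does; dec⇒maybe; _×-dec_)

import Algebra.Properties.CommutativeMonoid.Sum ℕ.+-0-commutativeMonoid as ℕΣ
import Algebra.Properties.CommutativeMonoid.Sum ℙ.+-0-commutativeMonoid as ℙΣ

private
  variable
    ℓ : Level
    Λ : Set ℓ
    k n : ℕ

inversions : Permutation′ n → ℕ
inversions π = ℕΣ.sum λ i → ℕΣ.sum λ j →
  if does (i <? j ×-dec (π ⟨$⟩ʳ j) <? (π ⟨$⟩ʳ i)) then 1 else 0

-- A finite set Λ with |Λ| = n is presented by an enumeration e : Λ ↔ Fin n.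
-- The parity of a permutation of Λ is that of its conjugate on Fin n; being
-- invariant under conjugation, it does not depend on e.
permParity : Λ ↔ Fin n → Λ ↔ Λ → Parity
permParity e π = parity (inversions (e ↔-∘ (π ↔-∘ ↔-sym e)))

sumOver : Λ ↔ Fin n → (Λ → Parity) → Parity
sumOver e f = ℙΣ.sum (f ∘ Inverse.from e)

record LatinSquare (Λ : Set ℓ) : Set ℓ where
  field
    entry         : Λ → Λ → Λ
    row-bijective : ∀ x → Bijective _≡_ _≡_ (λ y → entry x y)
    col-bijective : ∀ y → Bijective _≡_ _≡_ (λ x → entry x y)

  rowPerm : Λ → Λ ↔ Λ
  rowPerm x = ⤖⇒↔ (mk⤖ (row-bijective x))

  colPerm : Λ → Λ ↔ Λ
  colPerm y = ⤖⇒↔ (mk⤖ (col-bijective y))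

  -- The column in which the symbol s occurs in row x.
  symColumn : Λ → Λ → Λ
  symColumn s x = Inverse.from (rowPerm x) s

  entry-symColumn : ∀ s x → entry x (symColumn s x) ≡ s
  entry-symColumn s x = Inverse.inverseˡ (rowPerm x) refl

  symColumn-unique : ∀ {s x y} → entry x y ≡ s → symColumn s x ≡ y
  symColumn-unique {x = x} p = Inverse.inverseʳ (rowPerm x) (sym p)

  symColumn-bijective : ∀ s → Bijective _≡_ _≡_ (symColumn s)
  symColumn-bijective s = inj , surj
    where
    inj : Injective _≡_ _≡_ (symColumn s)
    inj {x} {x′} p = proj₁ (col-bijective (symColumn s x′))
      (trans (subst (λ y → entry x y ≡ s) p (entry-symColumn s x))
             (sym (entry-symColumn s x′)))

    surj : Surjective _≡_ _≡_ (symColumn s)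
    surj y = Inverse.from (colPerm y) s , λ where
      refl → symColumn-unique (Inverse.inverseˡ (colPerm y) refl)

  symPerm : Λ → Λ ↔ Λ
  symPerm s = ⤖⇒↔ (mk⤖ (symColumn-bijective s))

module _ (e : Λ ↔ Fin n) (L : LatinSquare Λ) where
  open LatinSquare L

  rowParity colParity symParity : Parity
  rowParity = sumOver e (permParity e ∘ rowPerm)
  colParity = sumOver e (permParity e ∘ colPerm)
  symParity = sumOver e (permParity e ∘ symPerm)

  Equiparity : Set
  Equiparity = rowParity ≡ colParity × colParity ≡ symParity

  equiparity? : Dec Equiparity
  equiparity? = (rowParity ℙ.≟ colParity) ×-dec (colParity ℙ.≟ symParity)

-- The condition |Λ| = n is not part of this record: it is supplied by an
-- enumeration Λ ↔ Fin n wherever orthogonal arrays are used.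
record OA (k n : ℕ) (Λ : Set ℓ) : Set ℓ where
  field
    array      : Fin (n ^ 2) → Fin k → Λ
    orthogonal : ∀ {i j} → i ≢ j → ∀ x y →
                 ∃! _≡_ λ r → array r i ≡ x × array r j ≡ y

record ColumnTriple (k : ℕ) : Set where
  constructor triple
  field
    {i j l} : Fin k
    i<j     : i < j
    j<l     : j < l

columnTriples : ∀ k → List (ColumnTriple k)
columnTriples k =
  mapMaybe increasing
    (cartesianProduct (allFin k) (cartesianProduct (allFin k) (allFin k)))
  where
  increasing : Fin k × Fin k × Fin k → Maybe (ColumnTriple k)
  increasing (i , j , l) =
    Maybe.map (λ (i<j , j<l) → triple i<j j<l)
              (dec⇒maybe (i <? j ×-dec j <? l))

module _ (A : OA k n Λ) where
  open OA A

  row : ∀ {i j} → i ≢ j → Λ → Λ → Fin (n ^ 2)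
  row i≢j x y = proj₁ (orthogonal i≢j x y)

  private
    row-fst : ∀ {i j} (i≢j : i ≢ j) x y → array (row i≢j x y) i ≡ x
    row-fst i≢j x y = proj₁ (proj₁ (proj₂ (orthogonal i≢j x y)))

    row-snd : ∀ {i j} (i≢j : i ≢ j) x y → array (row i≢j x y) j ≡ y
    row-snd i≢j x y = proj₂ (proj₁ (proj₂ (orthogonal i≢j x y)))

    row-unique : ∀ {i j} (i≢j : i ≢ j) {x y r} →
                 array r i ≡ x → array r j ≡ y → row i≢j x y ≡ r
    row-unique i≢j p q = proj₂ (proj₂ (orthogonal i≢j _ _)) (p , q)

    same-row : ∀ {i j} → i ≢ j → ∀ {r r′} →
               array r i ≡ array r′ i → array r j ≡ array r′ j → r ≡ r′
    same-row i≢j p q = trans (sym (row-unique i≢j p q)) (row-unique i≢j refl refl)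

  ensemble : ColumnTriple k → LatinSquare Λ
  ensemble (triple {i} {j} {l} i<j j<l) = record
    { entry         = entry
    ; row-bijective = λ x → row-injective x , row-surjective x
    ; col-bijective = λ y → col-injective y , col-surjective y
    }
    where
    i≢j : i ≢ j
    i≢j = <⇒≢ i<j

    j≢l : j ≢ l
    j≢l = <⇒≢ j<l

    i≢l : i ≢ l
    i≢l = <⇒≢ (<-trans i<j j<l)

    entry : Λ → Λ → Λ
    entry x y = array (row i≢j x y) l

    row-injective : ∀ x → Injective _≡_ _≡_ (λ y → entry x y)
    row-injective x {y} {y′} p =
      trans (sym (row-snd i≢j x y))
        (trans (cong (λ r → array r j)
                 (same-row i≢l (trans (row-fst i≢j x y) (sym (row-fst i≢j x y′))) p))
               (row-snd i≢j x y′))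

    row-surjective : ∀ x → Surjective _≡_ _≡_ (λ y → entry x y)
    row-surjective x s = array (row i≢l x s) j , λ where
      refl → trans (cong (λ r → array r l) (row-unique i≢j (row-fst i≢l x s) refl))
                   (row-snd i≢l x s)

    col-injective : ∀ y → Injective _≡_ _≡_ (λ x → entry x y)
    col-injective y {x} {x′} p =
      trans (sym (row-fst i≢j x y))
        (trans (cong (λ r → array r i)
                 (same-row j≢l (trans (row-snd i≢j x y) (sym (row-snd i≢j x′ y))) p))
               (row-fst i≢j x′ y))

    col-surjective : ∀ y → Surjective _≡_ _≡_ (λ x → entry x y)
    col-surjective y s = array (row j≢l y s) i , λ where
      refl → trans (cong (λ r → array r l) (row-unique i≢j refl (row-fst j≢l y s)))
                   (row-snd j≢l y s)

equiparityCount : Λ ↔ Fin n → OA k n Λ → ℕ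
equiparityCount {k = k} e A =
  length (filter (λ t → equiparity? e (ensemble A t)) (columnTriples k))

{-# OPTIONS --safe #-}

-- For distinct columns c, i, j let τ c i j be the sum over the symbols s of
-- the parities of the permutations from column i to column j in the rows with
-- s in column c, so that the three parities of the Latin square on i < j < l
-- are τ i j l, τ j i l and τ l i j. Counting inversions over pairs of rows and
-- splitting by the order in a third column gives, in ℤ₂,
--   τ c i j + τ c j l + τ c i l = 0  and  τ i j l + τ j i l + τ l i j = C(n,2)² = 0.
-- By the first, the pairs {i,j} with τ c i j = 1 form a cut on the n columns
-- other than c, hence number at most (n² − 1)/4, as n is odd; by the second,
-- a triple that is not equiparity accounts for exactly two such (c,{i,j}).
-- So at most (n + 1)(n² − 1)/8 of the (n + 1)n(n − 1)/6 triples are not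
-- equiparity.
module Submission where

open import Defs
open import Data.Fin.Base using (Fin)
open import Data.Nat.Base using (ℕ; _+_; _*_; _∸_; _≤_)
open import Data.Nat.DivMod using (_%_)
open import Function.Bundles using (_↔_)
open import Level using (Level)
open import Relation.Binary.PropositionalEquality.Core using (_≡_)

open import Data.Bool.Base using (if_then_else_)
open import Data.Fin.Base using (zero; suc; punchIn; _<_)
open import Data.Fin.Properties
  using (_<?_; _≟_; <-cmp; <-irrefl; <-trans; <⇒≢; punchIn-injective; punchInᵢ≢i)
open import Data.List.Base as List
  using (List; []; _∷_; _++_; allFin; cartesianProduct; filter; length; mapMaybe)
open import Data.List.Properties using (map-++; map-∘; map-tabulate)
open import Data.Maybe.Base as Maybe using (Maybe; just; nothing; maybe)
open import Data.Nat.Base using (_^_; parity; s≤s; z≤n) renaming (_<_ to _ℕ<_)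
open import Data.Nat.DivMod using (_/_; m≡m%n+[m/n]*n)
open import Data.Nat.ListAction using () renaming (sum to sumₗ)
open import Data.Nat.ListAction.Properties using (sum-++)
import Data.Nat.Properties as ℕ
open import Data.Nat.Properties
  using (+-*-semiring; +-cancelʳ-≡; +-comm; +-identityʳ;
         *-assoc; *-cancelˡ-≡; *-comm; *-identityˡ; *-zeroʳ)
open import Data.Nat.Tactic.RingSolver using (solve-∀)
open import Data.Parity.Base as ℙ using (Parity; 0ℙ; 1ℙ; _⁻¹)
import Data.Parity.Properties as ℙ
open import Data.Product using (_×_; _,_; proj₁; proj₂)
open import Function.Base using (_∘_)
open import Function.Bundles using (Inverse)
open import Function.Construct.Composition using (_↔-∘_)
open import Function.Construct.Symmetry using (↔-sym)
open import Relation.Binary.Definitions using (tri<; tri≈; tri>)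
open import Relation.Binary.PropositionalEquality
  using (_≢_; refl; sym; trans; cong; cong₂; subst; subst₂; module ≡-Reasoning)
open import Relation.Nullary.Decidable
  using (Dec; yes; no; does; dec-true; dec-false; _×-dec_)
open import Relation.Nullary.Decidable.Core using (dec⇒maybe)
open import Relation.Nullary.Negation using (¬_; contradiction)
import Relation.Unary

import Algebra.Properties.CommutativeMonoid.Sum ℙ.+-0-commutativeMonoid as ℙΣ
open import Algebra.Properties.Semiring.Sum +-*-semiring

open ≡-Reasoning

private
  variable
    ℓ : Level
    P : Set ℓ
    a b k m n : ℕ

-- Finite sums

∑∑-cong : {f g : Fin m → Fin n → ℕ} → (∀ i j → f i j ≡ g i j) →
          ∑[ i < m ] ∑[ j < n ] f i j ≡ ∑[ i < m ] ∑[ j < n ] g i j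
∑∑-cong f≗g = sum-cong-≗ λ i → sum-cong-≗ (f≗g i)

∑∑-distrib-+ : (f g : Fin m → Fin n → ℕ) →
               ∑[ i < m ] ∑[ j < n ] (f i j + g i j) ≡
               ∑[ i < m ] ∑[ j < n ] f i j + ∑[ i < m ] ∑[ j < n ] g i j
∑∑-distrib-+ f g = trans (sum-cong-≗ λ i → ∑-distrib-+ (f i) (g i))
                         (∑-distrib-+ (λ i → sum (f i)) (λ i → sum (g i)))

∑-zero : {f : Fin n → ℕ} → (∀ i → f i ≡ 0) → sum f ≡ 0
∑-zero {n} f≗0 = trans (sum-cong-≗ f≗0) (sum-replicate-zero n)

∑∑-zero : {f : Fin m → Fin n → ℕ} → (∀ i j → f i j ≡ 0) →
          ∑[ i < m ] ∑[ j < n ] f i j ≡ 0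
∑∑-zero f≗0 = ∑-zero λ i → ∑-zero (f≗0 i)

∑-const : ∀ n c → ∑[ i < n ] c ≡ n * c
∑-const ℕ.zero    c = refl
∑-const (ℕ.suc n) c = cong (c +_) (∑-const n c)

∑∑-product : (f : Fin m → ℕ) (g : Fin n → ℕ) →
             ∑[ i < m ] ∑[ j < n ] (f i * g j) ≡ sum f * sum g
∑∑-product f g = trans (sum-cong-≗ λ i → sym (*-distribˡ-sum (f i) g))
                       (sym (*-distribʳ-sum (sum g) f))

∑-single : (f : Fin n → ℕ) (i : Fin n) → (∀ j → j ≢ i → f j ≡ 0) → sum f ≡ f i
∑-single {ℕ.suc n} f i f≗0 = begin
  sum f                     ≡⟨ sum-remove {i = i} f ⟩
  f i + sum (f ∘ punchIn i) ≡⟨ cong (f i +_) (∑-zero λ j → f≗0 _ (punchInᵢ≢i i j)) ⟩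
  f i + 0                   ≡⟨ +-identityʳ (f i) ⟩
  f i                       ∎

∑∑-punchIn : (f : Fin (ℕ.suc n) → Fin (ℕ.suc n) → ℕ) (c : Fin (ℕ.suc n)) →
             (∀ j → f c j ≡ 0) → (∀ i → f i c ≡ 0) →
             ∑[ i < ℕ.suc n ] ∑[ j < ℕ.suc n ] f i j ≡
             ∑[ i < n ] ∑[ j < n ] f (punchIn c i) (punchIn c j)
∑∑-punchIn f c fc≗0 f-c≗0 = begin
  ∑[ i < _ ] ∑[ j < _ ] f i j
    ≡⟨ sum-remove {i = c} (λ i → sum (f i)) ⟩
  sum (f c) + ∑[ i < _ ] ∑[ j < _ ] f (punchIn c i) j
    ≡⟨ cong₂ _+_ (∑-zero fc≗0) (sum-cong-≗ λ i →
         trans (sum-remove {i = c} (f (punchIn c i)))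
               (cong (_+ sum (f (punchIn c i) ∘ punchIn c)) (f-c≗0 (punchIn c i)))) ⟩
  ∑[ i < _ ] ∑[ j < _ ] f (punchIn c i) (punchIn c j) ∎

-- Indicators

⟦_⟧ : Dec P → ℕ
⟦ P? ⟧ = if does P? then 1 else 0

⟦⟧-yes : (P? : Dec P) → P → ⟦ P? ⟧ ≡ 1
⟦⟧-yes P? p = cong (if_then 1 else 0) (dec-true P? p)

⟦⟧-no : (P? : Dec P) → ¬ P → ⟦ P? ⟧ ≡ 0
⟦⟧-no P? ¬p = cong (if_then 1 else 0) (dec-false P? ¬p)

⟦⟧-× : {Q : Set} (P? : Dec P) (Q? : Dec Q) → ⟦ P? ×-dec Q? ⟧ ≡ ⟦ P? ⟧ * ⟦ Q? ⟧
⟦⟧-× (yes _) (yes _) = refl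
⟦⟧-× (yes _) (no _)  = refl
⟦⟧-× (no _)  _           = refl

lt eq : Fin n → Fin n → ℕ
lt x y = ⟦ x <? y ⟧
eq x y = ⟦ x ≟ y ⟧

lt-yes : {x y : Fin n} → x < y → lt x y ≡ 1
lt-yes = ⟦⟧-yes (_ <? _)

lt-no : {x y : Fin n} → ¬ x < y → lt x y ≡ 0
lt-no = ⟦⟧-no (_ <? _)

lt-irrefl : (x : Fin n) → lt x x ≡ 0
lt-irrefl x = lt-no {x = x} (<-irrefl refl)

eq-yes : {x y : Fin n} → x ≡ y → eq x y ≡ 1
eq-yes = ⟦⟧-yes (_ ≟ _)

eq-no : {x y : Fin n} → x ≢ y → eq x y ≡ 0
eq-no = ⟦⟧-no (_ ≟ _)

eq-sym : (x y : Fin n) → eq x y ≡ eq y x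
eq-sym x y with x ≟ y
... | yes x≡y = sym (eq-yes (sym x≡y))
... | no  x≢y = sym (eq-no (x≢y ∘ sym))

trichotomy : (x y : Fin n) → lt x y + lt y x + eq x y ≡ 1
trichotomy x y with <-cmp x y
... | tri< x<y x≢y x≯y rewrite lt-yes x<y | lt-no x≯y | eq-no x≢y = refl
... | tri≈ x≮y x≡y x≯y rewrite lt-no x≮y | lt-no x≯y | eq-yes x≡y = refl
... | tri> x≮y x≢y x>y rewrite lt-no x≮y | lt-yes x>y | eq-no x≢y = refl

-- Weighted inversions between two rankings of the same points

Weight : ℕ → Set
Weight m = Fin m → Fin m → ℕ

-- For symmetric `w`, each unordered pair that `u` and `v` order oppositely counts once, taken in
-- the order in which `u` ascends.
inv : Weight m → (u v : Fin m → Fin n) → ℕ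
inv {m} w u v =
  ∑[ p < m ] ∑[ q < m ] (w p q * (lt (u p) (u q) * lt (v q) (v p)))

-- The pairs on which `x` is the odd one out: `u` and `v` strictly agree and `x` strictly opposes
-- both.
dissent : Weight m → (u v x : Fin m → Fin n) → ℕ
dissent {m} w u v x = ∑[ p < m ] ∑[ q < m ]
  (w p q * (lt (u p) (u q) * lt (v p) (v q) * lt (x q) (x p)))

_on-fibres-of_ : Weight m → (Fin m → Fin n) → Weight m
(w on-fibres-of x) p q = w p q * eq (x p) (x q)

Symmetric : Weight m → Set
Symmetric w = ∀ p q → w p q ≡ w q p

inv-sym : {w : Weight m} → Symmetric w → (u v : Fin m → Fin n) → inv w u v ≡ inv w v u
inv-sym {m} {w = w} w-sym u v = trans (∑-comm {m} {m} _) (∑∑-cong λ p q →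
  cong₂ _*_ (w-sym q p) (*-comm (lt (u q) (u p)) (lt (v p) (v q))))

dissent-sym : (w : Weight m) (u v x : Fin m → Fin n) → dissent w u v x ≡ dissent w v u x
dissent-sym w u v x = ∑∑-cong λ p q →
  cong (λ z → w p q * (z * lt (x q) (x p))) (*-comm (lt (u p) (u q)) (lt (v p) (v q)))

-- Trichotomy in `x`: on a pair ordered oppositely by `u` and `v`, the ranking `x` sides with `u`,
-- sides with `v`, or ties.
inv-split : {w : Weight m} → Symmetric w → (u v x : Fin m → Fin n) →
            inv w u v ≡ dissent w u x v + dissent w v x u + inv (w on-fibres-of x) u v
inv-split {m} {w = w} w-sym u v x = begin
  inv w u v
    ≡⟨ ∑∑-cong (λ p q → pointwise (w p q) (lt (u p) (u q)) (lt (v q) (v p))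
                          (lt (x p) (x q)) (lt (x q) (x p)) (eq (x p) (x q))
                          (trichotomy (x p) (x q))) ⟩
  ∑[ p < m ] ∑[ q < m ] (f p q + g p q + h p q)
    ≡⟨ trans (∑∑-distrib-+ (λ p q → f p q + g p q) h) (cong (_+ inv (w on-fibres-of x) u v) (∑∑-distrib-+ f g)) ⟩
  dissent w u x v + ∑[ p < m ] ∑[ q < m ] g p q + inv (w on-fibres-of x) u v
    -- In `g` the agreeing rankings `v` and `x` descend from `p` to `q`, while in `dissent` they
    -- ascend, so the two points are exchanged.
    ≡⟨ cong (λ z → dissent w u x v + z + inv (w on-fibres-of x) u v) (begin
         ∑[ p < m ] ∑[ q < m ] g p q ≡⟨ ∑-comm g ⟩
         ∑[ p < m ] ∑[ q < m ] g q p ≡⟨ ∑∑-cong (λ p q → cong (_* _) (w-sym q p)) ⟩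
         dissent w v x u             ∎) ⟩
  dissent w u x v + dissent w v x u + inv (w on-fibres-of x) u v ∎
  where
  f g h : Weight m
  f p q = w p q * (lt (u p) (u q) * lt (x p) (x q) * lt (v q) (v p))
  g p q = w p q * (lt (v q) (v p) * lt (x q) (x p) * lt (u p) (u q))
  h p q = w p q * eq (x p) (x q) * (lt (u p) (u q) * lt (v q) (v p))

  expand : ∀ w u v x x′ e → w * (u * v) * (x + x′ + e) ≡
           w * (u * x * v) + w * (v * x′ * u) + w * e * (u * v)
  expand = solve-∀

  pointwise : ∀ w u v x x′ e → x + x′ + e ≡ 1 →
              w * (u * v) ≡ w * (u * x * v) + w * (v * x′ * u) + w * e * (u * v)
  pointwise w u v x x′ e x+x′+e≡1 = begin
    w * (u * v)                  ≡⟨ sym (trans (*-comm (w * (u * v)) 1) (*-identityˡ _)) ⟩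
    w * (u * v) * 1              ≡⟨ cong (w * (u * v) *_) (sym x+x′+e≡1) ⟩
    w * (u * v) * (x + x′ + e)   ≡⟨ expand w u v x x′ e ⟩
    w * (u * x * v) + w * (v * x′ * u) + w * e * (u * v) ∎

-- When three rankings without ties on a pair do not all agree, one of them opposes the other two
-- and the pair is an inversion for exactly two of the three couples. So modulo 2 only tied pairs
-- remain. Both relations for `τ` are instances of this.
inv-three : {w : Weight m} → Symmetric w → (u v x : Fin m → Fin n) →
  inv w u v + inv w v x + inv w u x ≡
  2 * (dissent w u v x + dissent w v x u + dissent w u x v) +
  (inv (w on-fibres-of x) u v + inv (w on-fibres-of u) v x + inv (w on-fibres-of v) u x)
inv-three {w = w} w-sym u v x
  rewrite inv-split w-sym u v x | inv-split w-sym v x u | inv-split w-sym u x v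
        | dissent-sym w v u x | dissent-sym w x u v | dissent-sym w x v u
  = collect (dissent w u v x) (dissent w v x u) (dissent w u x v) _ _ _
  where
  collect : ∀ a b c d e f →
    (c + b + d) + (a + c + e) + (a + b + f) ≡ 2 * (a + b + c) + (d + e + f)
  collect = solve-∀

-- Orthogonal arrays

-- The points form an `a` by `b` grid. Any two distinct columns of an orthogonal array put the rows
-- in this form.
record IsCoordinates (ρ : Fin a → Fin b → Fin m) (x : Fin m → Fin a) (y : Fin m → Fin b) : Set where
  field
    x-ρ : ∀ i j → x (ρ i j) ≡ i
    y-ρ : ∀ i j → y (ρ i j) ≡ j
    ρ-xy : ∀ p → ρ (x p) (y p) ≡ p

  reindex : (f : Fin m → ℕ) → sum f ≡ ∑[ i < a ] ∑[ j < b ] f (ρ i j)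
  reindex f = begin
    sum f
      ≡⟨ sum-cong-≗ spread ⟩
    ∑[ p < m ] ∑[ i < a ] ∑[ j < b ] g i j p
      ≡⟨ trans (∑-comm (λ p i → ∑[ j < b ] g i j p))
               (sum-cong-≗ λ i → ∑-comm (λ p j → g i j p)) ⟩
    ∑[ i < a ] ∑[ j < b ] ∑[ p < m ] g i j p
      ≡⟨ ∑∑-cong gather ⟩
    ∑[ i < a ] ∑[ j < b ] f (ρ i j) ∎
    where
    -- The indicator of `ρ i j ≡ p` is inserted, and the sums are exchanged: summed over cells it
    -- leaves `f p`, summed over points it leaves `f (ρ i j)`.
    g : Fin a → Fin b → Fin m → ℕ
    g i j p = eq (ρ i j) p * f p

    g-diag : ∀ {i j p} → ρ i j ≡ p → g i j p ≡ f p
    g-diag {p = p} ρ≡p = trans (cong (_* f p) (eq-yes ρ≡p)) (*-identityˡ (f p))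

    g-off : ∀ {i j p} → ρ i j ≢ p → g i j p ≡ 0
    g-off {p = p} ρ≢p = cong (_* f p) (eq-no ρ≢p)

    gather : ∀ i j → ∑[ p < m ] g i j p ≡ f (ρ i j)
    gather i j = trans (∑-single (g i j) (ρ i j) (λ p p≢ρ → g-off (p≢ρ ∘ sym))) (g-diag refl)

    spread : ∀ p → f p ≡ ∑[ i < a ] ∑[ j < b ] g i j p
    spread p = sym (begin
      ∑[ i < a ] ∑[ j < b ] g i j p
        ≡⟨ ∑-single (λ i → ∑[ j < b ] g i j p) (x p) (λ i i≢ → ∑-zero λ j →
             g-off λ ρ≡p → i≢ (trans (sym (x-ρ i j)) (cong x ρ≡p))) ⟩
      ∑[ j < b ] g (x p) j p
        ≡⟨ ∑-single (λ j → g (x p) j p) (y p) (λ j j≢ →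
             g-off λ ρ≡p → j≢ (trans (sym (y-ρ (x p) j)) (cong y ρ≡p))) ⟩
      g (x p) (y p) p
        ≡⟨ g-diag (ρ-xy p) ⟩
      f p ∎)

  reindex² : (f : Fin m → Fin m → ℕ) → ∑[ p < m ] ∑[ q < m ] f p q ≡
             ∑[ i < a ] ∑[ j < b ] ∑[ i′ < a ] ∑[ j′ < b ] f (ρ i j) (ρ i′ j′)
  reindex² f = trans (reindex (λ p → sum (f p))) (∑∑-cong λ i j → reindex (f (ρ i j)))

one : Weight m
one _ _ = 1

-- The binomial coefficient `C(n,2)`.
ltPairs : ℕ → ℕ
ltPairs n = ∑[ x < n ] ∑[ y < n ] lt x y

module _ {ρ : Fin n → Fin n → Fin m} {x y : Fin m → Fin n} (xy : IsCoordinates ρ x y) where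
  open IsCoordinates xy

  -- The fibre of `x` over `i` is the line `j ↦ ρ i j`, along which `y` is just `j`. What remains
  -- are the inversions of `j ↦ z (ρ i j)`, summed over `i`.
  inv-on-fibres : (z : Fin m → Fin n) →
    inv (one on-fibres-of x) y z ≡
    ∑[ i < n ] ∑[ j < n ] ∑[ j′ < n ] (lt j j′ * lt (z (ρ i j′)) (z (ρ i j)))
  inv-on-fibres z = trans (reindex² _) (∑∑-cong λ i j → begin
    ∑[ i′ < n ] ∑[ j′ < n ] f i j i′ j′
      ≡⟨ ∑∑-cong (λ i′ j′ → cong₂ _*_
           (trans (*-identityˡ _) (cong₂ eq (x-ρ i j) (x-ρ i′ j′)))
           (cong (_* lt (z (ρ i′ j′)) (z (ρ i j))) (cong₂ lt (y-ρ i j) (y-ρ i′ j′)))) ⟩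
    ∑[ i′ < n ] ∑[ j′ < n ] (eq i i′ * g i j i′ j′)
      ≡⟨ ∑-single _ i (λ i′ i′≢i → ∑-zero λ j′ → cong (_* g i j i′ j′) (eq-no (i′≢i ∘ sym))) ⟩
    ∑[ j′ < n ] (eq i i * g i j i j′)
      ≡⟨ sum-cong-≗ (λ j′ → trans (cong (_* g i j i j′) (eq-yes {x = i} refl)) (*-identityˡ _)) ⟩
    ∑[ j′ < n ] g i j i j′ ∎)
    where
    g f : Fin n → Fin n → Fin n → Fin n → ℕ
    g i j i′ j′ = lt j j′ * lt (z (ρ i′ j′)) (z (ρ i j))
    f i j i′ j′ = 1 * eq (x (ρ i j)) (x (ρ i′ j′)) *
      (lt (y (ρ i j)) (y (ρ i′ j′)) * lt (z (ρ i′ j′)) (z (ρ i j)))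

  -- On a grid, an ascending pair of first coordinates and a descending pair of second coordinates
  -- are chosen independently.
  inv-coordinates : inv one x y ≡ ltPairs n * ltPairs n
  inv-coordinates = begin
    inv one x y
      ≡⟨ reindex² (λ p q → 1 * (lt (x p) (x q) * lt (y q) (y p))) ⟩
    ∑[ i < n ] ∑[ j < n ] ∑[ i′ < n ] ∑[ j′ < n ]
      (1 * (lt (x (ρ i j)) (x (ρ i′ j′)) * lt (y (ρ i′ j′)) (y (ρ i j))))
      ≡⟨ ∑∑-cong (λ i j → trans (∑∑-cong λ i′ j′ → trans (*-identityˡ _)
           (cong₂ _*_ (cong₂ lt (x-ρ i j) (x-ρ i′ j′)) (cong₂ lt (y-ρ i′ j′) (y-ρ i j))))
           (∑∑-product (λ i′ → lt i i′) (λ j′ → lt j′ j))) ⟩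
    ∑[ i < n ] ∑[ j < n ] (∑[ i′ < n ] lt i i′ * ∑[ j′ < n ] lt j′ j)
      ≡⟨ ∑∑-product (λ i → ∑[ i′ < n ] lt i i′) (λ j → ∑[ j′ < n ] lt j′ j) ⟩
    ltPairs n * ∑[ j < n ] ∑[ j′ < n ] lt j′ j
      ≡⟨ cong (ltPairs n *_) (∑-comm (λ (j j′ : Fin n) → lt j′ j)) ⟩
    ltPairs n * ltPairs n ∎

-- Counting pairs of symbols, and parities of sums

∑∑-eq : ∀ n → ∑[ x < n ] ∑[ y < n ] eq x y ≡ n
∑∑-eq n = begin
  ∑[ x < n ] ∑[ y < n ] eq x y
    ≡⟨ sum-cong-≗ (λ (x : Fin n) → trans (∑-single (eq x) x (λ y y≢x → eq-no (y≢x ∘ sym)))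
                              (eq-yes {x = x} refl)) ⟩
  ∑[ x < n ] 1 ≡⟨ ∑-const n 1 ⟩
  n * 1        ≡⟨ trans (*-comm n 1) (*-identityˡ n) ⟩
  n            ∎

ne : Fin n → Fin n → ℕ
ne x y = lt x y + lt y x

∑∑-ne : ∀ n → ∑[ x < n ] ∑[ y < n ] ne x y + n ≡ n * n
∑∑-ne n = begin
  ∑[ x < n ] ∑[ y < n ] ne x y + n
    ≡⟨ cong (∑[ x < n ] ∑[ y < n ] ne x y +_) (sym (∑∑-eq n)) ⟩
  ∑[ x < n ] ∑[ y < n ] ne x y + ∑[ x < n ] ∑[ y < n ] eq x y
    ≡⟨ sym (∑∑-distrib-+ {n} {n} ne eq) ⟩
  ∑[ x < n ] ∑[ y < n ] (ne x y + eq x y)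
    ≡⟨ ∑∑-cong {n} {n} trichotomy ⟩
  ∑[ x < n ] ∑[ y < n ] 1
    ≡⟨ trans (sum-cong-≗ {n} (λ _ → ∑-const n 1)) (∑-const n (n * 1)) ⟩
  n * (n * 1)
    ≡⟨ cong (n *_) (trans (*-comm n 1) (*-identityˡ n)) ⟩
  n * n ∎

ltPairs-double : ∀ n → 2 * ltPairs n + n ≡ n * n
ltPairs-double n = trans (cong (_+ n) (sym (begin
  ∑[ x < n ] ∑[ y < n ] ne x y
    ≡⟨ ∑∑-distrib-+ {n} {n} lt (λ x y → lt y x) ⟩
  ltPairs n + ∑[ x < n ] ∑[ y < n ] lt y x
    ≡⟨ cong (ltPairs n +_) (∑-comm {n} {n} (λ x y → lt y x)) ⟩
  ltPairs n + ltPairs n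
    ≡⟨ cong (ltPairs n +_) (sym (+-identityʳ (ltPairs n))) ⟩
  2 * ltPairs n ∎))) (∑∑-ne n)

%4≡1⇒≡ : ∀ n → n % 4 ≡ 1 → n ≡ 1 + n / 4 * 4
%4≡1⇒≡ n n%4≡1 = trans (m≡m%n+[m/n]*n n 4) (cong (_+ n / 4 * 4) n%4≡1)

parity-2* : ∀ x → parity (2 * x) ≡ 0ℙ
parity-2* x = ℙ.*-homo-* 2 x

-- With `n = 1 + 4q`, `C(n,2)` is `2q(1 + 4q)`; for residue 3 it would be odd.
ltPairs-even : ∀ n → n % 4 ≡ 1 → parity (ltPairs n) ≡ 0ℙ
ltPairs-even n n%4≡1 = trans (cong parity ltPairs≡) (parity-2* (q + 4 * q * q))
  where
  q = n / 4

  n≡ : n ≡ 1 + q * 4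
  n≡ = %4≡1⇒≡ n n%4≡1

  square : ∀ q → (1 + q * 4) * (1 + q * 4) ≡ 2 * (2 * (q + 4 * q * q)) + (1 + q * 4)
  square = solve-∀

  ltPairs≡ : ltPairs n ≡ 2 * (q + 4 * q * q)
  ltPairs≡ = *-cancelˡ-≡ _ _ 2 (+-cancelʳ-≡ n _ _ (begin
    2 * ltPairs n + n                  ≡⟨ ltPairs-double n ⟩
    n * n                              ≡⟨ cong₂ _*_ n≡ n≡ ⟩
    (1 + q * 4) * (1 + q * 4)          ≡⟨ square q ⟩
    2 * (2 * (q + 4 * q * q)) + (1 + q * 4) ≡⟨ cong (2 * (2 * (q + 4 * q * q)) +_) (sym n≡) ⟩
    2 * (2 * (q + 4 * q * q)) + n      ∎))

parity-∑ : (f : Fin n → ℕ) → ℙΣ.sum (parity ∘ f) ≡ parity (sum f)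
parity-∑ {ℕ.zero}  f = refl
parity-∑ {ℕ.suc n} f =
  trans (cong (parity (f zero) ℙ.+_) (parity-∑ (f ∘ suc)))
        (sym (ℙ.+-homo-+ (f zero) (sum (f ∘ suc))))

parity-2*+ : ∀ x y → parity (2 * x + y) ≡ parity y
parity-2*+ x y = trans (ℙ.+-homo-+ (2 * x) y) (cong (ℙ._+ parity y) (parity-2* x))

parity-+₃ : ∀ x y z → parity x ℙ.+ parity y ℙ.+ parity z ≡ parity (x + y + z)
parity-+₃ x y z = sym (trans (ℙ.+-homo-+ (x + y) z) (cong (ℙ._+ parity z) (ℙ.+-homo-+ x y)))

%4≡1⇒odd : ∀ n → n % 4 ≡ 1 → parity n ≡ 1ℙ
%4≡1⇒odd n n%4≡1 = trans (cong parity (trans (%4≡1⇒≡ n n%4≡1) (rearrange (n / 4))))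
                         (parity-2*+ (2 * (n / 4)) 1)
  where
  rearrange : ∀ q → 1 + q * 4 ≡ 2 * (2 * q) + 1
  rearrange = solve-∀

-- Parities of the permutations between columns of an orthogonal array

module _ {Λ : Set ℓ} (e : Λ ↔ Fin n) (A : OA k n Λ) where
  open OA A
  open Inverse e using (to; from; strictlyInverseˡ; strictlyInverseʳ)

  symbol : Fin k → Fin (n ^ 2) → Fin n
  symbol c p = to (array p c)

  rowAt : ∀ {i j} → i ≢ j → Fin n → Fin n → Fin (n ^ 2)
  rowAt i≢j x y = row A i≢j (from x) (from y)

  isCoordinates : ∀ {i j} (i≢j : i ≢ j) → IsCoordinates (rowAt i≢j) (symbol i) (symbol j)
  isCoordinates i≢j = record
    { x-ρ  = λ x y → trans (cong to (proj₁ (proj₁ (proj₂ (spec x y))))) (strictlyInverseˡ x)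
    ; y-ρ  = λ x y → trans (cong to (proj₂ (proj₁ (proj₂ (spec x y))))) (strictlyInverseˡ y)
    ; ρ-xy = λ p → proj₂ (proj₂ (spec (symbol _ p) (symbol _ p)))
                     (sym (strictlyInverseʳ _) , sym (strictlyInverseʳ _))
    }
    where
    spec = λ x y → orthogonal i≢j (from x) (from y)

  -- Column and symbol parities run over fibres of the later column. Flipping the coordinates,
  -- rather than exchanging the columns, keeps the row lookup used by `ensemble`, so the entries
  -- agree by `refl`.
  isCoordinates-flip : ∀ {i j} (i≢j : i ≢ j) →
    IsCoordinates (λ y x → rowAt i≢j x y) (symbol j) (symbol i)
  isCoordinates-flip i≢j = record
    { x-ρ = λ y x → y-ρ x y ; y-ρ = λ y x → x-ρ x y ; ρ-xy = ρ-xy }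
    where open IsCoordinates (isCoordinates i≢j)

  symbol-injective : ∀ {i j} → i ≢ j → ∀ {p q} →
    symbol i p ≡ symbol i q → symbol j p ≡ symbol j q → p ≡ q
  symbol-injective i≢j {p} {q} pᵢ≡qᵢ pⱼ≡qⱼ =
    trans (sym (ρ-xy p)) (trans (cong₂ (rowAt i≢j) pᵢ≡qᵢ pⱼ≡qⱼ) (ρ-xy q))
    where open IsCoordinates (isCoordinates i≢j)

  τ# : Fin k → Fin k → Fin k → ℕ
  τ# c i j = inv (one on-fibres-of symbol c) (symbol i) (symbol j)

  τ : Fin k → Fin k → Fin k → Parity
  τ c i j = parity (τ# c i j)

  on-fibres-symmetric : ∀ c → Symmetric (one on-fibres-of symbol c)
  on-fibres-symmetric c p q = cong (1 *_) (eq-sym (symbol c p) (symbol c q))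

  τ-sym : ∀ c i j → τ c i j ≡ τ c j i
  τ-sym c i j = cong parity (inv-sym (on-fibres-symmetric c) (symbol i) (symbol j))

  lt-same : ∀ (x : Fin n) {y} → x ≡ y → lt x y ≡ 0
  lt-same x refl = lt-irrefl x

  -- Two rows in one fibre of `c` are tied in `c`. Together with `τ-sym` and `τ-refl`, this makes
  -- sums of `τ` over all indices see only distinct columns.
  τ-fibre : ∀ c j → τ c c j ≡ 0ℙ
  τ-fibre c j = cong parity (∑∑-zero vanish)
    where
    vanish : ∀ p q → 1 * eq (symbol c p) (symbol c q) *
      (lt (symbol c p) (symbol c q) * lt (symbol j q) (symbol j p)) ≡ 0
    vanish p q with symbol c p ≟ symbol c q
    ... | no _ = refl
    ... | yes r = cong (λ z → 1 * (z * lt (symbol j q) (symbol j p))) (lt-same _ r)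

  τ-refl : ∀ c i → τ c i i ≡ 0ℙ
  τ-refl c i = cong parity (∑∑-zero λ p q →
    trans (cong (1 * eq (symbol c p) (symbol c q) *_) (vanish (symbol i p) (symbol i q)))
          (*-zeroʳ (1 * eq (symbol c p) (symbol c q))))
    where
    vanish : (x y : Fin n) → lt x y * lt y x ≡ 0
    vanish x y with <-cmp x y
    ... | tri< _ _ x≯y = trans (cong (lt x y *_) (lt-no x≯y)) (*-zeroʳ (lt x y))
    ... | tri≈ x≮y _ _ = cong (_* lt y x) (lt-no x≮y)
    ... | tri> x≮y _ _ = cong (_* lt y x) (lt-no x≮y)

  -- By orthogonality, rows that agree in two distinct columns are the same row, and a row forms no
  -- inversion with itself.
  inv-on-two-fibres : ∀ {c x} → c ≢ x → ∀ i j →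
    inv ((one on-fibres-of symbol c) on-fibres-of symbol x) (symbol i) (symbol j) ≡ 0
  inv-on-two-fibres {c} {x} c≢x i j = ∑∑-zero vanish
    where
    vanish : ∀ p q → 1 * eq (symbol c p) (symbol c q) * eq (symbol x p) (symbol x q) *
      (lt (symbol i p) (symbol i q) * lt (symbol j q) (symbol j p)) ≡ 0
    vanish p q with symbol c p ≟ symbol c q | symbol x p ≟ symbol x q
    ... | no  _ | _     = refl
    ... | yes _ | no  _ = refl
    ... | yes r | yes s =
      cong (λ z → 1 * (z * lt (symbol j q) (symbol j p)))
           (lt-same _ (cong (symbol i) (symbol-injective c≢x r s)))

  -- This is `inv-three` inside the fibres of `c`, where the tied terms vanish by
  -- `inv-on-two-fibres`. The columns `i`, `j`, `l` may coincide with one another.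
  τ-cut : ∀ {c} i j l → c ≢ i → c ≢ j → c ≢ l → τ c i j ℙ.+ τ c j l ℙ.+ τ c i l ≡ 0ℙ
  τ-cut {c} i j l c≢i c≢j c≢l = begin
    τ c i j ℙ.+ τ c j l ℙ.+ τ c i l
      ≡⟨ parity-+₃ (τ# c i j) (τ# c j l) (τ# c i l) ⟩
    parity (τ# c i j + τ# c j l + τ# c i l)
      ≡⟨ cong parity (inv-three (on-fibres-symmetric c) (symbol i) (symbol j) (symbol l)) ⟩
    parity (2 * D + (inv (W on-fibres-of symbol l) (symbol i) (symbol j) +
                     inv (W on-fibres-of symbol i) (symbol j) (symbol l) +
                     inv (W on-fibres-of symbol j) (symbol i) (symbol l)))
      ≡⟨ cong (λ z → parity (2 * D + z)) (cong₂ _+_ (cong₂ _+_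
           (inv-on-two-fibres c≢l i j) (inv-on-two-fibres c≢i j l)) (inv-on-two-fibres c≢j i l)) ⟩
    parity (2 * D + 0)
      ≡⟨ parity-2*+ D 0 ⟩
    0ℙ ∎
    where
    W = one on-fibres-of symbol c
    D = dissent W (symbol i) (symbol j) (symbol l)
      + dissent W (symbol j) (symbol l) (symbol i)
      + dissent W (symbol i) (symbol l) (symbol j)

  -- This is `inv-three` over all pairs of rows: the tied terms are now the three values of `τ#`,
  -- and each full inversion count is `C(n,2)` squared, which is even.
  τ-triple : n % 4 ≡ 1 → ∀ {i j l} → i ≢ j → j ≢ l → i ≢ l →
             τ l i j ℙ.+ τ i j l ℙ.+ τ j i l ≡ 0ℙ
  τ-triple n%4≡1 {i} {j} {l} i≢j j≢l i≢l = begin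
    τ l i j ℙ.+ τ i j l ℙ.+ τ j i l
      ≡⟨ parity-+₃ (τ# l i j) (τ# i j l) (τ# j i l) ⟩
    parity (τ# l i j + τ# i j l + τ# j i l)
      ≡⟨ parity-2*+ D _ ⟨
    parity (2 * D + (τ# l i j + τ# i j l + τ# j i l))
      ≡⟨ cong parity (inv-three {w = one} (λ _ _ → refl) (symbol i) (symbol j) (symbol l)) ⟨
    parity (inv one (symbol i) (symbol j) + inv one (symbol j) (symbol l) + inv one (symbol i) (symbol l))
      ≡⟨ cong parity (cong₂ _+_ (cong₂ _+_ (square i≢j) (square j≢l)) (square i≢l)) ⟩
    parity (L * L + L * L + L * L)
      ≡⟨ parity-+₃ (L * L) (L * L) (L * L) ⟨
    parity (L * L) ℙ.+ parity (L * L) ℙ.+ parity (L * L)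
      ≡⟨ cong (λ z → z ℙ.+ z ℙ.+ z) (trans (ℙ.*-homo-* L L)
           (cong (λ z → z ℙ.* z) (ltPairs-even n n%4≡1))) ⟩
    0ℙ ∎
    where
    L = ltPairs n
    D = dissent one (symbol i) (symbol j) (symbol l)
      + dissent one (symbol j) (symbol l) (symbol i)
      + dissent one (symbol i) (symbol l) (symbol j)
    square : ∀ {i j} → i ≢ j → inv one (symbol i) (symbol j) ≡ L * L
    square i≢j = inv-coordinates (isCoordinates i≢j)

  -- Conjugated to `Fin n`, the permutation `π x` sends the symbol of column `i` to that of column
  -- `j` along the fibre of `c` over `x`, so its inversions are those in `inv-on-fibres`.
  fibre-parity : ∀ {c i} {ρ : Fin n → Fin n → Fin (n ^ 2)} →
    IsCoordinates ρ (symbol c) (symbol i) → ∀ j →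
    (π : Fin n → Λ ↔ Λ) → (∀ x y → Inverse.to (π x) (from y) ≡ array (ρ x y) j) →
    ℙΣ.sum (permParity e ∘ π) ≡ τ c i j
  fibre-parity {c} {i} {ρ} coords j π π≡ = begin
    ℙΣ.sum (permParity e ∘ π)
      ≡⟨ parity-∑ (inversions ∘ conjugate) ⟩
    parity (∑[ x < n ] inversions (conjugate x))
      ≡⟨ cong parity (sum-cong-≗ λ x → ∑∑-cong λ y y′ →
           trans (⟦⟧-× (y <? y′) (Inverse.to (conjugate x) y′ <? Inverse.to (conjugate x) y)) (cong (lt y y′ *_)
             (cong₂ lt (cong to (π≡ x y′)) (cong to (π≡ x y))))) ⟩
    parity (∑[ x < n ] ∑[ y < n ] ∑[ y′ < n ] (lt y y′ * lt (symbol j (ρ x y′)) (symbol j (ρ x y))))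
      ≡⟨ cong parity (inv-on-fibres coords (symbol j)) ⟨
    τ c i j ∎
    where
    conjugate = λ x → e ↔-∘ (π x ↔-∘ ↔-sym e)

  module _ {i j l : Fin k} (i<j : i < j) (j<l : j < l) where
    private
      L = ensemble A (triple i<j j<l)
      open LatinSquare L

    rowParity≡τ : rowParity e L ≡ τ i j l
    rowParity≡τ = fibre-parity (isCoordinates (<⇒≢ i<j)) l (rowPerm ∘ from) λ _ _ → refl

    colParity≡τ : colParity e L ≡ τ j i l
    colParity≡τ = fibre-parity (isCoordinates-flip (<⇒≢ i<j)) l (colPerm ∘ from) λ _ _ → refl

    symParity≡τ : symParity e L ≡ τ l i j
    -- `symColumn s x` unfolds to the witness of row surjectivity in `ensemble`: the entry in column
    -- `j` of the row with `x` in column `i` and `s` in column `l`.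
    symParity≡τ = fibre-parity (isCoordinates-flip (<⇒≢ (<-trans i<j j<l))) j
      (symPerm ∘ from) λ _ _ → refl

-- Edges of a cut

bit : Parity → ℕ
bit 0ℙ = 0
bit 1ℙ = 1

-- Written as a sum of products, the indicator of differing colours factors when summed over all
-- pairs.
bit-+ : ∀ p q → bit (p ℙ.+ q) ≡ bit p * bit (q ⁻¹) + bit (p ⁻¹) * bit q
bit-+ 0ℙ 0ℙ = refl
bit-+ 0ℙ 1ℙ = refl
bit-+ 1ℙ 0ℙ = refl
bit-+ 1ℙ 1ℙ = refl

bit-⁻¹ : ∀ p → bit p + bit (p ⁻¹) ≡ 1
bit-⁻¹ 0ℙ = refl
bit-⁻¹ 1ℙ = refl

4xy<[x+y]²-ordered : ∀ {x y} → x ℕ< y → 4 * (x * y) + 1 ≤ (x + y) * (x + y)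
4xy<[x+y]²-ordered {x} {y} x<y =
  subst (λ y → 4 * (x * y) + 1 ≤ (x + y) * (x + y)) (ℕ.m+[n∸m]≡n x<y)
    (ℕ.≤-trans (ℕ.m≤m+n _ _) (ℕ.≤-reflexive (sym (expand x (y ∸ ℕ.suc x)))))
  where
  -- With `y = 1 + x + d`, the surplus `(y - x)²` is `1 + 2d + d²`.
  expand : ∀ x d → (x + (1 + x + d)) * (x + (1 + x + d)) ≡
                   (4 * (x * (1 + x + d)) + 1) + (2 * d + d * d)
  expand = solve-∀

4xy<[x+y]² : ∀ x y → x ≢ y → 4 * (x * y) + 1 ≤ (x + y) * (x + y)
4xy<[x+y]² x y x≢y with ℕ.<-cmp x y
... | tri≈ _ x≡y _ = contradiction x≡y x≢y
... | tri< x<y _ _ = 4xy<[x+y]²-ordered x<y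
... | tri> _ _ y<x = subst₂ _≤_ (cong (λ z → 4 * z + 1) (*-comm y x))
  (cong (λ z → z * z) (+-comm y x)) (4xy<[x+y]²-ordered y<x)

-- Colour classes of sizes `X` and `Y` give `2XY` ordered pairs across the cut. Since `X + Y = n` is
-- odd, the classes differ in size and the bound on `4XY` is strict.
cut-bound : (κ : Fin n → Parity) → parity n ≡ 1ℙ →
            2 * ∑[ i < n ] ∑[ j < n ] bit (κ i ℙ.+ κ j) + 1 ≤ n * n
cut-bound {n} κ odd = subst₂ _≤_
  (trans (sym (double X Y)) (cong (λ z → 2 * z + 1) (sym edges)))
  (cong (λ z → z * z) X+Y≡n)
  (4xy<[x+y]² X Y X≢Y)
  where
  X = ∑[ i < n ] bit (κ i)
  Y = ∑[ i < n ] bit (κ i ⁻¹)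

  double : ∀ x y → 2 * (x * y + y * x) + 1 ≡ 4 * (x * y) + 1
  double = solve-∀

  edges : ∑[ i < n ] ∑[ j < n ] bit (κ i ℙ.+ κ j) ≡ X * Y + Y * X
  edges = trans (∑∑-cong λ i j → bit-+ (κ i) (κ j))
    (trans (∑∑-distrib-+ (λ i j → bit (κ i) * bit (κ j ⁻¹)) (λ i j → bit (κ i ⁻¹) * bit (κ j)))
      (cong₂ _+_ (∑∑-product (bit ∘ κ) (λ j → bit (κ j ⁻¹)))
                 (∑∑-product (λ i → bit (κ i ⁻¹)) (bit ∘ κ))))

  X+Y≡n : X + Y ≡ n
  X+Y≡n = trans (sym (∑-distrib-+ (bit ∘ κ) (λ i → bit (κ i ⁻¹))))
    (trans (sum-cong-≗ (bit-⁻¹ ∘ κ)) (trans (∑-const n 1) (ℕ.*-identityʳ n)))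

  X≢Y : X ≢ Y
  X≢Y X≡Y = contradiction (trans (sym odd) (trans (cong parity (trans (sym X+Y≡n) X+Y≡2*X)) (parity-2* X))) λ ()
    where
    X+Y≡2*X : X + Y ≡ 2 * X
    X+Y≡2*X = cong (X +_) (trans (sym X≡Y) (sym (+-identityʳ X)))

-- Sums over unordered triples

-- The indicator of `i < j < l`, that is, of the triples listed by `columnTriples`.
χ : Fin k → Fin k → Fin k → ℕ
χ i j l = lt i j * lt j l

∑∑∑-cong : {f g : Fin k → Fin k → Fin k → ℕ} → (∀ i j l → f i j l ≡ g i j l) →
           ∑[ i < k ] ∑[ j < k ] ∑[ l < k ] f i j l ≡ ∑[ i < k ] ∑[ j < k ] ∑[ l < k ] g i j l
∑∑∑-cong f≗g = ∑∑-cong λ i j → sum-cong-≗ (f≗g i j)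

∑∑∑-distrib-+ : (f g : Fin k → Fin k → Fin k → ℕ) →
  ∑[ i < k ] ∑[ j < k ] ∑[ l < k ] (f i j l + g i j l) ≡
  ∑[ i < k ] ∑[ j < k ] ∑[ l < k ] f i j l + ∑[ i < k ] ∑[ j < k ] ∑[ l < k ] g i j l
∑∑∑-distrib-+ f g = trans (sum-cong-≗ λ i → ∑∑-distrib-+ (f i) (g i))
  (∑-distrib-+ (λ i → ∑[ j < _ ] ∑[ l < _ ] f i j l) (λ i → ∑[ j < _ ] ∑[ l < _ ] g i j l))

∑∑∑-*ˡ : ∀ a (f : Fin k → Fin k → Fin k → ℕ) →
  ∑[ i < k ] ∑[ j < k ] ∑[ l < k ] (a * f i j l) ≡ a * ∑[ i < k ] ∑[ j < k ] ∑[ l < k ] f i j l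
∑∑∑-*ˡ a f = sym (trans (*-distribˡ-sum a (λ i → ∑[ j < _ ] sum (f i j)))
  (sum-cong-≗ λ i → trans (*-distribˡ-sum a (λ j → sum (f i j)))
    (sum-cong-≗ λ j → *-distribˡ-sum a (f i j))))

-- For `i < j`, an index `c` other than these lies before, between or after them; the two hypotheses
-- dispose of `c` equal to either.
lt-position : ∀ {c i j : Fin k} (z : ℕ) → (c ≡ i → z ≡ 0) → (c ≡ j → z ≡ 0) →
              lt i j * z ≡ χ c i j * z + χ i c j * z + χ i j c * z
lt-position {c = c} {i} {j} z c≡i⇒ c≡j⇒ with <-cmp i j | <-cmp c i | <-cmp c j
... | _ | tri≈ _ c≡i _ | _
  rewrite c≡i⇒ c≡i | *-zeroʳ (lt i j) | *-zeroʳ (χ c i j) | *-zeroʳ (χ i c j) | *-zeroʳ (χ i j c) = refl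
... | _ | _ | tri≈ _ c≡j _
  rewrite c≡j⇒ c≡j | *-zeroʳ (lt i j) | *-zeroʳ (χ c i j) | *-zeroʳ (χ i c j) | *-zeroʳ (χ i j c) = refl
... | tri< i<j _ _ | tri< c<i _ i≮c | tri< c<j _ j≮c
  rewrite lt-yes i<j | lt-yes c<i | lt-no i≮c | lt-no j≮c =
  sym (trans (+-identityʳ (z + 0 + 0)) (+-identityʳ (z + 0)))
... | tri< i<j _ _ | tri< c<i _ _ | tri> c≮j _ _ = contradiction (<-trans c<i i<j) c≮j
... | tri< i<j _ _ | tri> c≮i _ i<c | tri< c<j _ j≮c
  rewrite lt-yes i<j | lt-no c≮i | lt-yes i<c | lt-yes c<j | lt-no j≮c = sym (+-identityʳ (z + 0))
... | tri< i<j _ _ | tri> c≮i _ i<c | tri> c≮j _ j<c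
  rewrite lt-yes i<j | lt-no c≮i | lt-yes i<c | lt-no c≮j | lt-yes j<c = refl
... | tri≈ i≮j _ _ | tri< _ _ i≮c | _
  rewrite lt-no i≮j | lt-no i≮c | *-zeroʳ (lt c i) = refl
... | tri≈ i≮j _ _ | tri> _ _ i<c | tri< c<j _ _ = contradiction (<-trans i<c c<j) i≮j
... | tri≈ i≮j _ _ | tri> _ _ _ | tri> c≮j _ _
  rewrite lt-no i≮j | lt-no c≮j | *-zeroʳ (lt c i) | *-zeroʳ (lt i c) = refl
... | tri> i≮j _ _ | tri< _ _ i≮c | _
  rewrite lt-no i≮j | lt-no i≮c | *-zeroʳ (lt c i) = refl
... | tri> i≮j _ _ | tri> _ _ i<c | tri< c<j _ _ = contradiction (<-trans i<c c<j) i≮j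
... | tri> i≮j _ _ | tri> _ _ _ | tri> c≮j _ _
  rewrite lt-no i≮j | lt-no c≮j | *-zeroʳ (lt c i) | *-zeroʳ (lt i c) = refl

∑∑-symmetric : (f : Fin k → Fin k → ℕ) → (∀ i j → f i j ≡ f j i) → (∀ i → f i i ≡ 0) →
               ∑[ i < k ] ∑[ j < k ] f i j ≡ 2 * ∑[ i < k ] ∑[ j < k ] (lt i j * f i j)
∑∑-symmetric {k} f f-sym f-refl = begin
  ∑[ i < k ] ∑[ j < k ] f i j
    ≡⟨ ∑∑-cong pointwise ⟩
  ∑[ i < k ] ∑[ j < k ] (lt i j * f i j + lt j i * f j i)
    ≡⟨ ∑∑-distrib-+ (λ i j → lt i j * f i j) (λ i j → lt j i * f j i) ⟩
  S + ∑[ i < k ] ∑[ j < k ] (lt j i * f j i)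
    ≡⟨ cong (S +_) (trans (∑-comm (λ i j → lt j i * f j i)) (sym (+-identityʳ S))) ⟩
  2 * S ∎
  where
  S = ∑[ i < k ] ∑[ j < k ] (lt i j * f i j)

  pointwise : ∀ i j → f i j ≡ lt i j * f i j + lt j i * f j i
  pointwise i j with <-cmp i j
  ... | tri< i<j _ j≮i rewrite lt-yes i<j | lt-no j≮i =
    sym (trans (+-identityʳ (f i j + 0)) (+-identityʳ (f i j)))
  ... | tri> i≮j _ j<i rewrite lt-yes j<i | lt-no i≮j =
    trans (f-sym i j) (sym (+-identityʳ (f j i)))
  ... | tri≈ _ refl _ rewrite f-refl i | *-zeroʳ (lt i i) = refl

-- The factor 2 comes from the order of the last two arguments; the three summands come from the
-- distinguished argument being the least, the middle or the greatest of the triple.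
∑∑∑-symmetric : (f : Fin k → Fin k → Fin k → ℕ) → (∀ c i j → f c i j ≡ f c j i) →
  (∀ c i → f c i i ≡ 0) → (∀ c j → f c c j ≡ 0) →
  ∑[ c < k ] ∑[ i < k ] ∑[ j < k ] f c i j ≡
  2 * ∑[ i < k ] ∑[ j < k ] ∑[ l < k ] (χ i j l * (f i j l + f j i l + f l i j))
∑∑∑-symmetric {k} f f-sym f-refl f-fst = begin
  ∑[ c < k ] ∑[ i < k ] ∑[ j < k ] f c i j
    ≡⟨ sum-cong-≗ (λ c → ∑∑-symmetric (f c) (f-sym c) (f-refl c)) ⟩
  ∑[ c < k ] (2 * ∑[ i < k ] ∑[ j < k ] (lt i j * f c i j))
    ≡⟨ sym (*-distribˡ-sum 2 (λ c → ∑[ i < k ] ∑[ j < k ] (lt i j * f c i j))) ⟩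
  2 * ∑[ c < k ] ∑[ i < k ] ∑[ j < k ] (lt i j * f c i j)
    ≡⟨ cong (2 *_) (begin
       ∑[ c < k ] ∑[ i < k ] ∑[ j < k ] (lt i j * f c i j)
         ≡⟨ ∑∑∑-cong (λ c i j → lt-position {c = c} {i} {j} (f c i j)
              (λ { refl → f-fst c j }) (λ { refl → trans (f-sym c i c) (f-fst c i) })) ⟩
       ∑[ c < k ] ∑[ i < k ] ∑[ j < k ] (F c i j + G c i j + H c i j)
         ≡⟨ trans (∑∑∑-distrib-+ (λ c i j → F c i j + G c i j) H)
                  (cong (_+ ∑[ c < k ] ∑[ i < k ] ∑[ j < k ] H c i j) (∑∑∑-distrib-+ F G)) ⟩
       ∑[ c < k ] ∑[ i < k ] ∑[ j < k ] F c i j +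
       ∑[ c < k ] ∑[ i < k ] ∑[ j < k ] G c i j +
       ∑[ c < k ] ∑[ i < k ] ∑[ j < k ] H c i j
         -- In `G` the distinguished index is the middle one, in `H` the greatest. Exchanging sums
         -- moves it to that position.
         ≡⟨ cong₂ (λ x y → ∑[ c < k ] ∑[ i < k ] ∑[ j < k ] F c i j + x + y)
              (∑-comm (λ c i → ∑[ j < k ] G c i j))
              (trans (∑-comm (λ c i → ∑[ j < k ] H c i j))
                     (sum-cong-≗ λ i → ∑-comm (λ c j → H c i j))) ⟩
       ∑[ i < k ] ∑[ j < k ] ∑[ l < k ] F i j l +
       ∑[ i < k ] ∑[ j < k ] ∑[ l < k ] G j i l +
       ∑[ i < k ] ∑[ j < k ] ∑[ l < k ] H l i j
         ≡⟨ trans (∑∑∑-distrib-+ (λ i j l → F i j l + G j i l) (λ i j l → H l i j))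
              (cong (_+ ∑[ i < k ] ∑[ j < k ] ∑[ l < k ] H l i j)
                (∑∑∑-distrib-+ F (λ i j l → G j i l))) ⟨
       ∑[ i < k ] ∑[ j < k ] ∑[ l < k ] (F i j l + G j i l + H l i j)
         ≡⟨ ∑∑∑-cong (λ i j l → factor (χ i j l) (f i j l) (f j i l) (f l i j)) ⟩
       ∑[ i < k ] ∑[ j < k ] ∑[ l < k ] (χ i j l * (f i j l + f j i l + f l i j)) ∎) ⟩
  2 * ∑[ i < k ] ∑[ j < k ] ∑[ l < k ] (χ i j l * (f i j l + f j i l + f l i j)) ∎
  where
  F G H : Fin k → Fin k → Fin k → ℕ
  F c i j = χ c i j * f c i j
  G c i j = χ i c j * f c i j
  H c i j = χ i j c * f c i j

  factor : ∀ w x y z → w * x + w * y + w * z ≡ w * (x + y + z)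
  factor = solve-∀

ne-≢ : {x y : Fin n} → x ≢ y → ne x y ≡ 1
ne-≢ {x = x} {y} x≢y = trans (sym (+-identityʳ (ne x y)))
  (trans (cong (ne x y +_) (sym (eq-no x≢y))) (trichotomy x y))

ne-refl : (x : Fin n) → ne x x ≡ 0
ne-refl x = cong (λ z → z + z) (lt-irrefl x)

distinct : Fin k → Fin k → Fin k → ℕ
distinct c i j = ne c i * ne c j * ne i j

∑∑-distinct : (c : Fin (ℕ.suc n)) →
              ∑[ i < ℕ.suc n ] ∑[ j < ℕ.suc n ] distinct c i j + n ≡ n * n
∑∑-distinct {n} c = trans (cong (_+ n) (begin
  ∑[ i < ℕ.suc n ] ∑[ j < ℕ.suc n ] distinct c i j
    ≡⟨ ∑∑-punchIn (distinct c) c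
         (λ j → cong (λ z → z * ne c j * ne c j) (ne-refl c))
         (λ i → trans (cong (λ z → ne c i * z * ne i c) (ne-refl c))
                      (cong (_* ne i c) (*-zeroʳ (ne c i)))) ⟩
  ∑[ i < n ] ∑[ j < n ] distinct c (punchIn c i) (punchIn c j)
    ≡⟨ ∑∑-cong (λ i j → trans (cong₂ (λ x y → x * y * ne (punchIn c i) (punchIn c j))
         (ne-≢ (punchInᵢ≢i c i ∘ sym)) (ne-≢ (punchInᵢ≢i c j ∘ sym)))
         (trans (*-identityˡ _) (ne-punchIn i j))) ⟩
  ∑[ i < n ] ∑[ j < n ] ne i j ∎)) (∑∑-ne n)
  where
  ne-punchIn : ∀ i j → ne (punchIn c i) (punchIn c j) ≡ ne i j
  ne-punchIn i j with i ≟ j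
  ... | yes refl = trans (ne-refl (punchIn c i)) (sym (ne-refl i))
  ... | no i≢j   = trans (ne-≢ (i≢j ∘ punchIn-injective c i j)) (sym (ne-≢ i≢j))

-- Applied to `distinct`, `∑∑∑-symmetric` counts each increasing triple `2 * 3` times, while
-- `∑∑-distinct` evaluates the sum over all ordered triples.
∑∑∑-χ : ∀ n → 6 * ∑[ i < ℕ.suc n ] ∑[ j < ℕ.suc n ] ∑[ l < ℕ.suc n ] χ i j l ≡
        ℕ.suc n * (n * (n ∸ 1))
∑∑∑-χ n = begin
  6 * X           ≡⟨ *-assoc 2 3 X ⟩
  2 * (3 * X)     ≡⟨ cong (2 *_) (sym (trans (∑∑∑-cong pointwise) (∑∑∑-*ˡ 3 (χ {ℕ.suc n})))) ⟩
  2 * ∑[ i < ℕ.suc n ] ∑[ j < ℕ.suc n ] ∑[ l < ℕ.suc n ]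
    (χ i j l * (distinct i j l + distinct j i l + distinct l i j))
    ≡⟨ ∑∑∑-symmetric {ℕ.suc n} distinct distinct-sym
         (λ c i → trans (cong (ne c i * ne c i *_) (ne-refl i)) (*-zeroʳ (ne c i * ne c i)))
         (λ c j → cong (λ z → z * ne c j * ne c j) (ne-refl c)) ⟨
  ∑[ c < ℕ.suc n ] ∑[ i < ℕ.suc n ] ∑[ j < ℕ.suc n ] distinct c i j
    ≡⟨ sum-cong-≗ (λ c → +-cancelʳ-≡ n _ _ (trans (∑∑-distinct c) (n² n))) ⟩
  ∑[ c < ℕ.suc n ] (n * (n ∸ 1))
    ≡⟨ ∑-const (ℕ.suc n) (n * (n ∸ 1)) ⟩
  ℕ.suc n * (n * (n ∸ 1)) ∎
  where
  X = ∑[ i < ℕ.suc n ] ∑[ j < ℕ.suc n ] ∑[ l < ℕ.suc n ] χ i j l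

  n² : ∀ n → n * n ≡ n * (n ∸ 1) + n
  n² ℕ.zero    = refl
  n² (ℕ.suc m) = trans (ℕ.*-suc (ℕ.suc m) m) (+-comm (ℕ.suc m) (ℕ.suc m * m))

  distinct-sym : ∀ (c i j : Fin (ℕ.suc n)) → distinct c i j ≡ distinct c j i
  distinct-sym c i j = cong₂ _*_ (*-comm (ne c i) (ne c j)) (+-comm (lt i j) (lt j i))

  pointwise : ∀ (i j l : Fin (ℕ.suc n)) → χ i j l * (distinct i j l + distinct j i l + distinct l i j) ≡ 3 * χ i j l
  pointwise i j l with <-cmp i j | <-cmp j l
  ... | tri≈ i≮j _ _ | _ rewrite lt-no i≮j = refl
  ... | tri> i≮j _ _ | _ rewrite lt-no i≮j = refl
  ... | tri< _ _ _ | tri≈ j≮l _ _ rewrite lt-no j≮l | *-zeroʳ (lt i j) = refl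
  ... | tri< _ _ _ | tri> j≮l _ _ rewrite lt-no j≮l | *-zeroʳ (lt i j) = refl
  ... | tri< i<j i≢j _ | tri< j<l j≢l _
    rewrite ne-≢ i≢j | ne-≢ (i≢j ∘ sym) | ne-≢ j≢l | ne-≢ (j≢l ∘ sym)
          | ne-≢ (<⇒≢ (<-trans i<j j<l)) | ne-≢ (<⇒≢ (<-trans i<j j<l) ∘ sym) = *-comm (χ i j l) 3

∑-mono-≤ : {f g : Fin n → ℕ} → (∀ i → f i ≤ g i) → sum f ≤ sum g
∑-mono-≤ {ℕ.zero}  f≤g = z≤n
∑-mono-≤ {ℕ.suc n} f≤g = ℕ.+-mono-≤ (f≤g zero) (∑-mono-≤ (f≤g ∘ suc))

-- Counting in lists

∑-tabulate : (f : Fin n → ℕ) → sumₗ (List.tabulate f) ≡ sum f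
∑-tabulate {ℕ.zero}  f = refl
∑-tabulate {ℕ.suc n} f = cong (f zero +_) (∑-tabulate (f ∘ suc))

∑-allFin : (f : Fin n → ℕ) → sumₗ (List.map f (allFin n)) ≡ sum f
∑-allFin f = trans (cong sumₗ (map-tabulate (λ i → i) f)) (∑-tabulate f)

sum-cartesianProduct : {A B : Set} (f : A × B → ℕ) (xs : List A) (ys : List B) →
  sumₗ (List.map f (cartesianProduct xs ys)) ≡
  sumₗ (List.map (λ x → sumₗ (List.map (λ y → f (x , y)) ys)) xs)
sum-cartesianProduct f []       ys = refl
sum-cartesianProduct f (x ∷ xs) ys = begin
  sumₗ (List.map f (List.map (x ,_) ys ++ cartesianProduct xs ys))
    ≡⟨ cong sumₗ (map-++ f (List.map (x ,_) ys) (cartesianProduct xs ys)) ⟩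
  sumₗ (List.map f (List.map (x ,_) ys) ++ List.map f (cartesianProduct xs ys))
    ≡⟨ sum-++ (List.map f (List.map (x ,_) ys)) (List.map f (cartesianProduct xs ys)) ⟩
  sumₗ (List.map f (List.map (x ,_) ys)) + sumₗ (List.map f (cartesianProduct xs ys))
    ≡⟨ cong₂ _+_ (cong sumₗ (sym (map-∘ ys))) (sum-cartesianProduct f xs ys) ⟩
  sumₗ (List.map (λ y → f (x , y)) ys) +
  sumₗ (List.map (λ x → sumₗ (List.map (λ y → f (x , y)) ys)) xs) ∎

∑∑∑-cartesianProduct : (f : Fin k × Fin k × Fin k → ℕ) →
  sumₗ (List.map f (cartesianProduct (allFin k) (cartesianProduct (allFin k) (allFin k)))) ≡
  ∑[ i < k ] ∑[ j < k ] ∑[ l < k ] f (i , j , l)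
∑∑∑-cartesianProduct {k} f = begin
  sumₗ (List.map f (cartesianProduct (allFin k) pairs))
    ≡⟨ trans (sum-cartesianProduct f (allFin k) pairs) (∑-allFin λ i → sumₗ (List.map (λ p → f (i , p)) pairs)) ⟩
  ∑[ i < k ] sumₗ (List.map (λ p → f (i , p)) pairs)
    ≡⟨ sum-cong-≗ (λ i → trans (sum-cartesianProduct (λ p → f (i , p)) (allFin k) (allFin k))
         (∑-allFin λ j → sumₗ (List.map (λ l → f (i , j , l)) (allFin k)))) ⟩
  ∑[ i < k ] ∑[ j < k ] sumₗ (List.map (λ l → f (i , j , l)) (allFin k))
    ≡⟨ ∑∑-cong (λ i j → ∑-allFin (λ l → f (i , j , l))) ⟩
  ∑[ i < k ] ∑[ j < k ] ∑[ l < k ] f (i , j , l) ∎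
  where
  pairs = cartesianProduct (allFin k) (allFin k)

length-filter-mapMaybe : {A B : Set} {Q : B → Set} (Q? : Relation.Unary.Decidable Q)
  (f : A → Maybe B) (xs : List A) →
  length (filter Q? (mapMaybe f xs)) ≡ sumₗ (List.map (maybe (λ y → ⟦ Q? y ⟧) 0 ∘ f) xs)
length-filter-mapMaybe Q? f [] = refl
length-filter-mapMaybe Q? f (x ∷ xs) with f x
... | nothing = length-filter-mapMaybe Q? f xs
... | just y with Q? y
...   | yes _ = cong ℕ.suc (length-filter-mapMaybe Q? f xs)
...   | no  _ = length-filter-mapMaybe Q? f xs

-- Counting equiparity squares

equiparity-bits : ∀ {p q r p′ q′ r′} → p ≡ p′ → q ≡ q′ → r ≡ r′ → r′ ℙ.+ p′ ℙ.+ q′ ≡ 0ℙ →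
  2 * ⟦ (p ℙ.≟ q) ×-dec (q ℙ.≟ r) ⟧ + (bit p′ + bit q′ + bit r′) ≡ 2
-- Three bits with sum zero contain no ones or two ones, so they are all equal only when all vanish.
equiparity-bits {0ℙ} {0ℙ} {0ℙ} refl refl refl _ = refl
equiparity-bits {0ℙ} {1ℙ} {1ℙ} refl refl refl _ = refl
equiparity-bits {1ℙ} {0ℙ} {1ℙ} refl refl refl _ = refl
equiparity-bits {1ℙ} {1ℙ} {0ℙ} refl refl refl _ = refl

module _ {Λ : Set ℓ} (e : Λ ↔ Fin n) where

  τ-bits : OA k n Λ → Fin k → Fin k → Fin k → ℕ
  τ-bits A c i j = bit (τ e A c i j)

  equiparityCount-identity : n % 4 ≡ 1 → (A : OA k n Λ) →
    2 * equiparityCount e A + ∑[ i < k ] ∑[ j < k ] ∑[ l < k ]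
      (χ i j l * (τ-bits A i j l + τ-bits A j i l + τ-bits A l i j)) ≡
    2 * ∑[ i < k ] ∑[ j < k ] ∑[ l < k ] χ i j l
  equiparityCount-identity {k} n%4≡1 A = begin
    2 * equiparityCount e A + ∑[ i < k ] ∑[ j < k ] ∑[ l < k ] (χ i j l * S i j l)
      ≡⟨ cong (λ z → 2 * z + ∑[ i < k ] ∑[ j < k ] ∑[ l < k ] (χ i j l * S i j l))
           (trans (length-filter-mapMaybe (λ t → equiparity? e (ensemble A t)) _
                    (cartesianProduct (allFin k) (cartesianProduct (allFin k) (allFin k))))
                  (∑∑∑-cartesianProduct {k} _)) ⟩
    2 * ∑[ i < k ] ∑[ j < k ] ∑[ l < k ] E i j l + ∑[ i < k ] ∑[ j < k ] ∑[ l < k ] (χ i j l * S i j l)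
      ≡⟨ cong (_+ ∑[ i < k ] ∑[ j < k ] ∑[ l < k ] (χ i j l * S i j l)) (∑∑∑-*ˡ 2 E) ⟨
    ∑[ i < k ] ∑[ j < k ] ∑[ l < k ] (2 * E i j l) + ∑[ i < k ] ∑[ j < k ] ∑[ l < k ] (χ i j l * S i j l)
      ≡⟨ ∑∑∑-distrib-+ (λ i j l → 2 * E i j l) (λ i j l → χ i j l * S i j l) ⟨
    ∑[ i < k ] ∑[ j < k ] ∑[ l < k ] (2 * E i j l + χ i j l * S i j l)
      ≡⟨ ∑∑∑-cong pointwise ⟩
    ∑[ i < k ] ∑[ j < k ] ∑[ l < k ] (2 * χ i j l)
      ≡⟨ ∑∑∑-*ˡ 2 (χ {k}) ⟩
    2 * ∑[ i < k ] ∑[ j < k ] ∑[ l < k ] χ i j l ∎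
    where
    S E : Fin k → Fin k → Fin k → ℕ
    S i j l = τ-bits A i j l + τ-bits A j i l + τ-bits A l i j
    E i j l = maybe (λ t → ⟦ equiparity? e (ensemble A t) ⟧) 0
      (Maybe.map (λ (i<j , j<l) → triple i<j j<l) (dec⇒maybe (i <? j ×-dec j <? l)))

    pointwise : ∀ i j l → 2 * E i j l + χ i j l * S i j l ≡ 2 * χ i j l
    pointwise i j l = cases (i <? j) (j <? l)
      where
      -- Taking the two decisions as arguments lets the list selection and the indicators in `χ`
      -- reduce together.
      cases : (i<?j : Dec (i < j)) (j<?l : Dec (j < l)) →
        2 * maybe (λ t → ⟦ equiparity? e (ensemble A t) ⟧) 0
          (Maybe.map (λ (i<j , j<l) → triple i<j j<l) (dec⇒maybe (i<?j ×-dec j<?l))) +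
        ⟦ i<?j ⟧ * ⟦ j<?l ⟧ * S i j l ≡ 2 * (⟦ i<?j ⟧ * ⟦ j<?l ⟧)
      cases (no _)    _         = refl
      cases (yes _)   (no _)    = refl
      cases (yes i<j) (yes j<l) =
        trans (cong (2 * ⟦ equiparity? e (ensemble A (triple i<j j<l)) ⟧ +_) (*-identityˡ (S i j l)))
          (equiparity-bits (rowParity≡τ e A i<j j<l) (colParity≡τ e A i<j j<l) (symParity≡τ e A i<j j<l)
            (τ-triple e A n%4≡1 (<⇒≢ i<j) (<⇒≢ j<l) (<⇒≢ (<-trans i<j j<l))))

  -- Each column other than `c` is coloured by its `τ` value against a fixed base column. By
  -- `τ-cut`, `τ c i j` is then the sum of two colours, and `cut-bound` applies to the `n` remaining
  -- columns.
  ∑∑-τ-bits : parity n ≡ 1ℙ → (A : OA (ℕ.suc n) n Λ) → ∀ c →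
    2 * ∑[ i < ℕ.suc n ] ∑[ j < ℕ.suc n ] τ-bits A c i j + 1 ≤ n * n
  ∑∑-τ-bits odd A c = subst (λ z → 2 * z + 1 ≤ n * n)
    (sym (trans (∑∑-punchIn (τ-bits A c) c
        (λ j → cong bit (τ-fibre e A c j))
        (λ i → cong bit (trans (τ-sym e A c i c) (τ-fibre e A c i))))
      (∑∑-cong λ i j → cong bit (coloured i j))))
    (cut-bound κ odd)
    where
    -- Oddness excludes `n = 0`, so a base column exists.
    base : ∀ {n} → parity n ≡ 1ℙ → Fin n
    base {ℕ.suc _} _ = zero

    κ : Fin n → Parity
    κ i = τ e A c (punchIn c i) (punchIn c (base odd))

    coloured : ∀ i j → τ e A c (punchIn c i) (punchIn c j) ≡ κ i ℙ.+ κ j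
    coloured i j = solve-cut _ _ _ (τ-cut e A (punchIn c i) (punchIn c j) (punchIn c (base odd))
        (punchInᵢ≢i c i ∘ sym) (punchInᵢ≢i c j ∘ sym) (punchInᵢ≢i c (base odd) ∘ sym))
      where
      solve-cut : ∀ p q r → p ℙ.+ q ℙ.+ r ≡ 0ℙ → p ≡ r ℙ.+ q
      solve-cut 0ℙ 0ℙ 0ℙ _ = refl
      solve-cut 0ℙ 1ℙ 1ℙ _ = refl
      solve-cut 1ℙ 0ℙ 1ℙ _ = refl
      solve-cut 1ℙ 1ℙ 0ℙ _ = refl

  ∑∑∑-τ-bits : parity n ≡ 1ℙ → (A : OA (ℕ.suc n) n Λ) →
    2 * ∑[ c < ℕ.suc n ] ∑[ i < ℕ.suc n ] ∑[ j < ℕ.suc n ] τ-bits A c i j + ℕ.suc n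
      ≤ ℕ.suc n * (n * n)
  ∑∑∑-τ-bits odd A = subst₂ _≤_
    (trans (∑-distrib-+ {ℕ.suc n} (λ c → 2 * T c) (λ _ → 1))
      (cong₂ _+_ (sym (*-distribˡ-sum 2 T)) (trans (∑-const (ℕ.suc n) 1) (ℕ.*-identityʳ (ℕ.suc n)))))
    (∑-const (ℕ.suc n) (n * n))
    (∑-mono-≤ (∑∑-τ-bits odd A))
    where
    T : Fin (ℕ.suc n) → ℕ
    T c = ∑[ i < ℕ.suc n ] ∑[ j < ℕ.suc n ] τ-bits A c i j

-- `24E = 24X - 12S = 4(n+1)n(n-1) - 6T`, and `6T` is at most `3(n+1)(n² - 1)`; the difference is
-- `(n+1)(n-1)(n-3)`.
counting-inequality : ∀ {n} → 3 ≤ n → ∀ E S T X →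
  2 * E + S ≡ 2 * X → 6 * X ≡ ℕ.suc n * (n * (n ∸ 1)) → T ≡ 2 * S →
  2 * T + ℕ.suc n ≤ ℕ.suc n * (n * n) →
  ℕ.suc n * (n ∸ 1) * (n ∸ 3) ≤ 24 * E
counting-inequality (s≤s (s≤s (s≤s {n = m} _))) E S T X 2E+S≡2X 6X≡ T≡2S T≤ =
  -- Here `n = 3 + m`, which resolves the truncated subtractions. Adding three times the left side
  -- of the bound on `T` to both sides avoids any further subtraction.
  ℕ.+-cancelʳ-≤ (3 * (2 * T + (4 + m))) _ _
    (subst ((4 + m) * (2 + m) * m + 3 * (2 * T + (4 + m)) ≤_) total
      (ℕ.+-monoʳ-≤ ((4 + m) * (2 + m) * m) (ℕ.*-monoʳ-≤ 3 T≤)))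
  where
  polynomial : ∀ m → (4 + m) * (2 + m) * m + 3 * ((4 + m) * ((3 + m) * (3 + m))) ≡
                     4 * ((4 + m) * ((3 + m) * (2 + m))) + 3 * (4 + m)
  polynomial = solve-∀

  regroup₁ : ∀ x m → 4 * (6 * x) + 3 * (4 + m) ≡ 12 * (2 * x) + 3 * (4 + m)
  regroup₁ = solve-∀

  regroup₂ : ∀ e s m → 12 * (2 * e + s) + 3 * (4 + m) ≡ 24 * e + 3 * (2 * (2 * s) + (4 + m))
  regroup₂ = solve-∀

  total : (4 + m) * (2 + m) * m + 3 * ((4 + m) * ((3 + m) * (3 + m))) ≡
          24 * E + 3 * (2 * T + (4 + m))
  total = begin
    (4 + m) * (2 + m) * m + 3 * ((4 + m) * ((3 + m) * (3 + m))) ≡⟨ polynomial m ⟩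
    4 * ((4 + m) * ((3 + m) * (2 + m))) + 3 * (4 + m) ≡⟨ cong (λ z → 4 * z + 3 * (4 + m)) 6X≡ ⟨
    4 * (6 * X) + 3 * (4 + m)                         ≡⟨ regroup₁ X m ⟩
    12 * (2 * X) + 3 * (4 + m)                        ≡⟨ cong (λ z → 12 * z + 3 * (4 + m)) 2E+S≡2X ⟨
    12 * (2 * E + S) + 3 * (4 + m)                    ≡⟨ regroup₂ E S m ⟩
    24 * E + 3 * (2 * (2 * S) + (4 + m))              ≡⟨ cong (λ z → 24 * E + 3 * (2 * z + (4 + m))) T≡2S ⟨
    24 * E + 3 * (2 * T + (4 + m))                    ∎

-- Keeping the number of columns a variable lets `n + 1` become `ℕ.suc n` by matching on an
-- equation, without transporting the array.
equiparityCount-bound : ∀ {Λ : Set ℓ} {k n} → k ≡ ℕ.suc n → 3 ≤ n → n % 4 ≡ 1 →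
  (e : Λ ↔ Fin n) (A : OA k n Λ) →
  k * (n ∸ 1) * (n ∸ 3) ≤ 24 * equiparityCount e A
equiparityCount-bound {k = k} {n} refl 3≤n n%4≡1 e A = counting-inequality 3≤n
  (equiparityCount e A)
  (∑[ i < k ] ∑[ j < k ] ∑[ l < k ] (χ i j l * (t i j l + t j i l + t l i j)))
  (∑[ c < k ] ∑[ i < k ] ∑[ j < k ] t c i j)
  (∑[ i < k ] ∑[ j < k ] ∑[ l < k ] χ i j l)
  (equiparityCount-identity e n%4≡1 A)
  (∑∑∑-χ n)
  (∑∑∑-symmetric t
    (λ c i j → cong bit (τ-sym e A c i j))
    (λ c i → cong bit (τ-refl e A c i))
    (λ c j → cong bit (τ-fibre e A c j)))
  (∑∑∑-τ-bits e (%4≡1⇒odd n n%4≡1) A)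
  where
  t = τ-bits e A

theorem6p4 : ∀ {ℓ : Level} {Λ : Set ℓ} (n : ℕ) → 2 ≤ n → n % 4 ≡ 1 →
    (e : Λ ↔ Fin n) (A : OA (n + 1) n Λ) →
    (n + 1) * (n ∸ 1) * (n ∸ 3) ≤ 24 * equiparityCount e A
theorem6p4 n 2≤n n%4≡1 e A = equiparityCount-bound (+-comm n 1)
  -- The residue excludes `n = 2`, so `3 ≤ n`.
  (ℕ.≤∧≢⇒< 2≤n λ { refl → contradiction n%4≡1 λ () }) n%4≡1 e A
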